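{- Let $(T_n)_{n\ge -3}$ be the Padovan sequence. For all integers $m\ge 0$ and $n\ge 0$, $$T_{m+n}=T_{m-1}T_n+T_mT_{n-1}+(T_{m+1}-T_{m-1})T_{n-2}.$$
   Context: The Padovan sequence is the integer sequence defined by $T_0=0$, $T_1=1$, $T_2=1$ and $T_{n+3}=T_{n+1}+T_n$ for all $n\ge 0$, extended to negative indices by $T_{ -1}=1$, $T_{ -2}=0$, $T_{ -3}=0$ (so that the recurrence holds for all $n\ge -3$). -}

module Defs where

open import Data.Integer using (ℤ; +_; -[1+_]; 0ℤ; 1ℤ; _+_; _-_; -_; _≤_; -≤-)
open import Data.Nat using (suc; s≤s)
open import Relation.Binary.PropositionalEquality using (_≡_; refl)

-- The Padovan sequence.  Recall that -[1+ k ] denotes -(1 + k), so the negative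
-- clauses give T₋₁, T₋₂, T₋₃.  Only indices ≥ -3 are of interest; the last clause
-- runs the recurrence backwards, T₋₍ₖ₊₄₎ = T₋₍ₖ₊₁₎ - T₋₍ₖ₊₂₎, to make T total on ℤ.
T : ℤ → ℤ
T (+ 0)                     = 0ℤ
T (+ 1)                     = 1ℤ
T (+ 2)                     = 1ℤ
T (+ suc (suc (suc n)))     = T (+ suc n) + T (+ n)
T -[1+ 0 ]                  = 1ℤ
T -[1+ 1 ]                  = 0ℤ
T -[1+ 2 ]                  = 0ℤ
T -[1+ suc (suc (suc k)) ]  = T -[1+ k ] - T -[1+ suc k ]

T-recurrence : ∀ n → - (+ 3) ≤ n → T (+ 3 + n) ≡ T (+ 1 + n) + T n
T-recurrence (+ n)    _ = refl
T-recurrence -[1+ 0 ] _ = refl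
T-recurrence -[1+ 1 ] _ = refl
T-recurrence -[1+ 2 ] _ = refl
T-recurrence -[1+ suc (suc (suc _)) ] (-≤- (s≤s (s≤s ())))

{-# OPTIONS --safe #-}

-- For fixed n both sides satisfy the Padovan recurrence in m, so it suffices
-- to compare them at m = 0, 1, 2.
module Submission where

open import Data.Integer using (ℤ; +_; 0ℤ; 1ℤ; _+_; _-_; _*_; _≤_)
open import Data.Integer.Tactic.RingSolver using (solve-∀)
open import Data.Nat as ℕ using (ℕ; zero; suc)
open import Relation.Binary.PropositionalEquality using (_≡_; refl; sym; trans; cong₂)
open import Defs

-- As a function of `m`, the right-hand side is a combination of shifts of `T` with coefficients
-- free of `m`, so it inherits the linear recurrence. At `m` = 0, 1, 2 it collapses to T_n, T_{n-1}
-- + T_{n-2} and T_n + T_{n-1}, which are T_n, T_{n+1} and T_{n+2}.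

PadovanRecurrence : (ℕ → ℤ) → Set
PadovanRecurrence f = ∀ k → f (3 ℕ.+ k) ≡ f (1 ℕ.+ k) + f k

PadovanRecurrence-unique : ∀ {f g} → PadovanRecurrence f → PadovanRecurrence g →
  f 0 ≡ g 0 → f 1 ≡ g 1 → f 2 ≡ g 2 → ∀ k → f k ≡ g k
PadovanRecurrence-unique {f} {g} rf rg e₀ e₁ e₂ = go
  where
  go : ∀ k → f k ≡ g k
  go 0 = e₀
  go 1 = e₁
  go 2 = e₂
  go (suc (suc (suc k))) =
    trans (rf k) (trans (cong₂ _+_ (go (suc k)) (go k)) (sym (rg k)))

T[m-1]-recurrence : PadovanRecurrence (λ m → T (+ m - + 1))
T[m-1]-recurrence zero    = refl
T[m-1]-recurrence (suc _) = refl

-- At `n` = 0 and 1 the right side reaches the values at -1 and -2; from 2 on it is the defining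
-- clause.
T[1+n] : ∀ n → T (+ suc n) ≡ T (+ n - + 1) + T (+ n - + 2)
T[1+n] 0             = refl
T[1+n] 1             = refl
T[1+n] (suc (suc _)) = refl

T[2+n] : ∀ n → T (+ suc (suc n)) ≡ T (+ n) + T (+ n - + 1)
T[2+n] zero    = refl
T[2+n] (suc _) = refl

-- `x`, `y`, `z` stand for T_n, T_{n-1}, T_{n-2}; left arbitrary, they isolate the dependence on
-- `m`.
combination : (x y z : ℤ) → ℕ → ℤ
combination x y z m =
  T (+ m - + 1) * x + T (+ m) * y + (T (+ m + + 1) - T (+ m - + 1)) * z

combination-recurrence : ∀ x y z → PadovanRecurrence (combination x y z)
combination-recurrence x y z k rewrite T[m-1]-recurrence k =
  -- The recurrences at `m` and `m + 1` hold by computation, so only additivity remains.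
  additive (T (+ suc k - + 1)) (T (+ k - + 1)) (T (+ suc k)) (T (+ k))
           (T (+ suc k + + 1)) (T (+ k + + 1)) x y z
  where
  additive : ∀ u u′ v v′ w w′ x y z →
    (u + u′) * x + (v + v′) * y + ((w + w′) - (u + u′)) * z ≡
    (u * x + v * y + (w - u) * z) + (u′ * x + v′ * y + (w′ - u′) * z)
  additive = solve-∀

-- The coefficients evaluate to (1, 0, 0) here, and to (0, 1, 1) and (1, 1, 0) at 1 and 2.
combination-0 : ∀ x y z → x ≡ combination x y z 0
combination-0 = identity
  where
  identity : ∀ x y z → x ≡ 1ℤ * x + 0ℤ * y + 0ℤ * z
  identity = solve-∀

combination-1 : ∀ x y z → y + z ≡ combination x y z 1
combination-1 = identity
  where
  identity : ∀ x y z → y + z ≡ 0ℤ * x + 1ℤ * y + 1ℤ * z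
  identity = solve-∀

combination-2 : ∀ x y z → x + y ≡ combination x y z 2
combination-2 = identity
  where
  identity : ∀ x y z → x + y ≡ 1ℤ * x + 1ℤ * y + 0ℤ * z
  identity = solve-∀

mainTheorem2 : (m n : ℤ) → 0ℤ ≤ m → 0ℤ ≤ n →
    T (m + n) ≡ T (m - + 1) * T n + T m * T (n - + 1) + (T (m + + 1) - T (m - + 1)) * T (n - + 2)
mainTheorem2 (+ m) (+ n) _ _ =
  PadovanRecurrence-unique {λ k → T (+ k + + n)} {combination x y z}
    -- A shift by `n` preserves the recurrence definitionally.
    (λ _ → refl)
    (combination-recurrence x y z)
    (combination-0 x y z)
    (trans (T[1+n] n) (combination-1 x y z))
    (trans (T[2+n] n) (combination-2 x y z))
    m
  where
  x y z : ℤ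
  x = T (+ n)
  y = T (+ n - + 1)
  z = T (+ n - + 2)
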